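{- Let $r\ge 3$ and $m$ be positive integers with $r<m/2$, and let $m=b\,k^{r-1}$ with $b,k\in\mathbb{N}$ and $b$ the smallest positive integer for which such a representation exists; assume $m$ is composite and $k\ge 2$. Consider the search for a girth maximum $(m,r)$ BTU lying in $\Phi(\beta_1,\ldots,\beta_{r-1})$, where $\beta_i$ is the partition of $bk^{r-1}$ into $k^{r-1-i}$ parts each equal to $bk^i$ ($1\le i\le r-1$), and let $1\le i\le r-2$. Then the search space for the permutation $q_i\in S_{bk^i}$, where $p_i=k^{r-1-i}\ast q_i\in S_{bk^{r-1}}$, can be mapped to a Cayley graph of the symmetric group of degree $bk^i-1$; that is, there is a bijection from the set $A_{(bk^i)}(I_{bk^i})$ onto the vertex set of a Cayley graph of the symmetric group $S_{bk^i-1}$.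
   Context: An $(m,r)$ BTU is an $r$-regular bipartite graph with $m$ vertices on each side, equivalently an $m\times m$ $0/1$ matrix with exactly $r$ nonzero entries in every row and column; a labeled one has labeled rows and columns. A labeled $(m,r)$ BTU is girth maximum if no labeled $(m,r)$ BTU has larger girth (length of a shortest cycle). Permutations are in one-line notation $p=(x_1\ldots x_m)$, with permutation matrix having ones in positions $(i,x_i)$; $I_n$ is the identity in $S_n$. Two permutations $(x_1\ldots x_m),(y_1\ldots y_m)$ are compatible if $x_i\neq y_i$ for all $i$. Pairwise compatible $p_1,\dots,p_r\in S_m$ represent the BTU whose matrix is the sum of their permutation matrices. $P_2(m)$ is the set of partitions of $m$ into parts at least $2$. The partition between two compatible permutations $p,q\in S_m$ is the partition in $P_2(m)$ whose parts are half the lengths of the cycles of the $(m,2)$ BTU they represent; it equals $(m)$ when that BTU is a single cycle of length $2m$. $\Phi(\beta_1,\dots,\beta_{r-1})$ is the family of labeled $(m,r)$ BTUs represented by pairwise compatible $p_1,\dots,p_r\in S_m$, ordered so that their first entries satisfy $p_1(1)<p_2(1)<\dots<p_r(1)$, with the partition between $p_{i-1}$ and $p_i$ equal to $\beta_{i-1}$ for $1<i\le r$. For $q\in S_n$ and a positive integer $c$, $c\ast q\in S_{cn}$ is the permutation whose matrix is block diagonal with $c$ copies of the matrix of $q$. For $p\in S_n$, $A_{(n)}(p)$ denotes the set of permutations $q\in S_n$ compatible with $p$ such that the partition between $q$ and $p$ is $(n)$. In the search, after rearranging the rows and columns of the BTU so that the reference permutation is the identity $I_{bk^i}$, the search space for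 $q_i\in S_{bk^i}$ is the set $A_{(bk^i)}(I_{bk^i})$. -}

module Defs where

open import Algebra.Bundles using (Group)
open import Algebra.Properties.Monoid.Sum using (sum)
open import Data.Bool.Base using (if_then_else_)
open import Data.Empty.Polymorphic using (⊥)
open import Data.Fin.Base as Fin using (Fin; zero; suc; toℕ; fromℕ; inject₁)
import Data.Fin.Properties as Fin
open import Data.Fin.Permutation as Perm
  using (Permutation′; _⟨$⟩ʳ_; _∘ₚ_; flip; inverseˡ; inverseʳ)
open import Data.List.Base as List using (List; []; _∷_; map; replicate)
import Data.Nat.ListAction as ListAction
open import Data.List.Relation.Binary.Permutation.Propositional using (_↭_)
open import Data.List.Relation.Unary.All using (All; []; _∷_)
import Data.List.Relation.Unary.All.Properties as All
open import Data.List.Relation.Unary.AllPairs using (AllPairs)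
open import Data.List.Relation.Unary.Any using (Any)
open import Data.Nat.Base hiding (_⊔_)
open import Data.Nat.Primality using (Composite)
open import Data.Nat.Properties
open import Data.Product.Base using (Σ-syntax; ∃-syntax; _×_; _,_; proj₁)
open import Data.Product.Function.NonDependent.Propositional using (_×-↔_)
open import Data.Sum.Base using (_⊎_; inj₁; inj₂)
open import Data.Vec.Base using (tabulate; count)
import Data.Vec.Functional as Vector
open import Function.Bundles using (_⇔_)
open import Function.Construct.Composition using (_↔-∘_)
open import Function.Construct.Identity using (↔-id)
open import Function.Construct.Symmetry using (↔-sym)
open import Function.Definitions using (Injective)
open import Level using (Level; 0ℓ; _⊔_) renaming (suc to lsuc)
open import Relation.Binary.Bundles using (Setoid)
open import Relation.Binary.Core using (Rel)
open import Relation.Binary.Definitions using (Symmetric; Irreflexive; _Respects₂_; _Respects_)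
import Relation.Binary.Construct.On as On
open import Relation.Binary.PropositionalEquality
  using (_≡_; _≢_; refl; sym; trans; cong; subst; setoid; resp₂; module ≡-Reasoning)
open import Relation.Nullary.Decidable using (does; ¬?)
open import Relation.Nullary.Negation using (¬_)
open import Relation.Unary using (Pred; _∈_; _∉_)

private
  variable
    a c ℓ e : Level

record Graph (a ℓ e : Level) : Set (lsuc (a ⊔ ℓ ⊔ e)) where
  field
    Vertices : Setoid a ℓ
  open Setoid Vertices public using (_≈_) renaming (Carrier to Vertex)
  field
    Adj       : Rel Vertex e
    adj-resp  : Adj Respects₂ _≈_
    adj-sym   : Symmetric Adj
    adj-irrfl : Irreflexive _≈_ Adj

module _ (G : Graph a ℓ e) where
  open Graph G

  record Cycle : Set (a ⊔ ℓ ⊔ e) where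
    field
      last      : ℕ
      at        : Fin (suc last) → Vertex
      long      : 3 ≤ suc last
      injective : Injective _≡_ _≈_ at
      step      : ∀ j → Adj (at (inject₁ j)) (at (suc j))
      close     : Adj (at (fromℕ last)) (at zero)

    length : ℕ
    length = suc last

    Traverses : Rel Vertex ℓ
    Traverses x y = (∃[ j ] at (inject₁ j) ≈ x × at (suc j) ≈ y)
                  ⊎ (at (fromℕ last) ≈ x × at zero ≈ y)

    Edge : Rel Vertex ℓ
    Edge x y = Traverses x y ⊎ Traverses y x

  -- A cycle is a subgraph: its starting point and orientation are
  -- immaterial.
  SameCycle : Rel Cycle (a ⊔ ℓ)
  SameCycle C D = ∀ x y → Cycle.Edge C x y ⇔ Cycle.Edge D x y

  record CycleList : Set (a ⊔ ℓ ⊔ e) where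
    field
      cycles   : List Cycle
      distinct : AllPairs (λ C D → ¬ SameCycle C D) cycles
      complete : ∀ C → Any (SameCycle C) cycles

    lengths : List ℕ
    lengths = map Cycle.length cycles

  -- An acyclic graph has no girth in this sense.
  HasGirth : ℕ → Set (a ⊔ ℓ ⊔ e)
  HasGirth g = (Σ[ C ∈ Cycle ] Cycle.length C ≡ g)
             × (∀ C → g ≤ Cycle.length C)

module _ (G : Group c ℓ) where
  open Group G

  record ConnectionSet : Set (lsuc (c ⊔ ℓ)) where
    field
      S            : Pred Carrier (c ⊔ ℓ)
      respects     : S Respects _≈_
      identity-∉   : ε ∉ S
      inverse-∈    : ∀ {s} → s ∈ S → s ⁻¹ ∈ S
      -- S is closed under inverses, so words in S suffice.
      generates    : ∀ g → Σ[ w ∈ List Carrier ] All S w × List.foldr _∙_ ε w ≈ g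

  cayleyGraph : ConnectionSet → Graph c ℓ (c ⊔ ℓ)
  cayleyGraph CS = record
    { Vertices  = Group.setoid G
    ; Adj       = λ x y → x ⁻¹ ∙ y ∈ S
    ; adj-resp  = (λ y≈y′ → respects (∙-congˡ y≈y′))
                , (λ x≈x′ → respects (∙-congʳ (⁻¹-cong x≈x′)))
    ; adj-sym   = λ {x} {y} s → respects (flip-quotient x y) (inverse-∈ s)
    ; adj-irrfl = λ {x} {y} x≈y s → identity-∉
        (respects (Group.trans G (∙-congʳ (⁻¹-cong x≈y)) (inverseˡ′ y)) s)
    }
    where
    open ConnectionSet CS
    open import Algebra.Properties.Group G using (⁻¹-anti-homo-∙; ⁻¹-involutive)
    inverseˡ′ : ∀ y → y ⁻¹ ∙ y ≈ ε
    inverseˡ′ = Group.inverseˡ G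
    flip-quotient : ∀ x y → (x ⁻¹ ∙ y) ⁻¹ ≈ y ⁻¹ ∙ x
    flip-quotient x y =
      Group.trans G (⁻¹-anti-homo-∙ (x ⁻¹) y) (∙-congˡ (⁻¹-involutive x))

Sym : ℕ → Group 0ℓ 0ℓ
Sym n = record
  { Carrier = Permutation′ n
  ; _≈_     = Perm._≈_
  ; _∙_     = λ π ρ → ρ ∘ₚ π
  ; ε       = Perm.id
  ; _⁻¹     = flip
  ; isGroup = record
    { isMonoid = record
      { isSemigroup = record
        { isMagma = record
          { isEquivalence = record
            { refl  = λ _ → refl
            ; sym   = λ π≈ρ i → sym (π≈ρ i)
            ; trans = λ π≈ρ ρ≈σ i → trans (π≈ρ i) (ρ≈σ i)
            }
          ; ∙-cong = λ {π} {π′} {ρ} {ρ′} π≈π′ ρ≈ρ′ i →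
              trans (cong (π ⟨$⟩ʳ_) (ρ≈ρ′ i)) (π≈π′ (ρ′ ⟨$⟩ʳ i))
          }
        ; assoc = λ _ _ _ _ → refl
        }
      ; identity = (λ _ _ → refl) , (λ _ _ → refl)
      }
    ; inverse = (λ π _ → inverseˡ π) , (λ π _ → inverseʳ π)
    ; ⁻¹-cong = λ {π} {ρ} π≈ρ i →
        trans (sym (inverseˡ ρ))
          (cong (flip ρ ⟨$⟩ʳ_) (trans (sym (π≈ρ (flip π ⟨$⟩ʳ i))) (inverseʳ π)))
    }
  }

Matrix : ℕ → Set
Matrix m = Fin m → Fin m → ℕ

-- Rows are the vertices inj₁ i, columns the vertices inj₂ j.
bipartiteGraph : ∀ {m} → Matrix m → Graph 0ℓ 0ℓ 0ℓ
bipartiteGraph {m} M = record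
  { Vertices  = setoid (Fin m ⊎ Fin m)
  ; Adj       = Adj
  ; adj-resp  = resp₂ Adj
  ; adj-sym   = λ {x} {y} → adj-sym x y
  ; adj-irrfl = λ { {x} refl → adj-irrfl x }
  }
  where
  Adj : Rel (Fin m ⊎ Fin m) 0ℓ
  Adj (inj₁ i) (inj₂ j) = M i j ≡ 1
  Adj (inj₂ j) (inj₁ i) = M i j ≡ 1
  Adj (inj₁ _) (inj₁ _) = ⊥
  Adj (inj₂ _) (inj₂ _) = ⊥

  adj-sym : ∀ x y → Adj x y → Adj y x
  adj-sym (inj₁ _) (inj₂ _) p = p
  adj-sym (inj₂ _) (inj₁ _) p = p

  adj-irrfl : ∀ x → ¬ Adj x x
  adj-irrfl (inj₁ _) ()
  adj-irrfl (inj₂ _) ()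

nonzeros : ∀ {m} → (Fin m → ℕ) → ℕ
nonzeros v = count (λ x → ¬? (x ≟ 0)) (tabulate v)

record BTU (m r : ℕ) : Set where
  field
    matrix   : Matrix m
    zero-one : ∀ i j → matrix i j ≡ 0 ⊎ matrix i j ≡ 1
    rows     : ∀ i → nonzeros (λ j → matrix i j) ≡ r
    columns  : ∀ j → nonzeros (λ i → matrix i j) ≡ r

  graph : Graph 0ℓ 0ℓ 0ℓ
  graph = bipartiteGraph matrix

GirthMaximum : ∀ {m r} → Pred (BTU m r) 0ℓ
GirthMaximum {m} {r} B = ∃[ g ] HasGirth (BTU.graph B) g
  × (∀ (B′ : BTU m r) g′ → HasGirth (BTU.graph B′) g′ → g′ ≤ g)

permutationMatrix : ∀ {m} → Permutation′ m → Matrix m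
permutationMatrix p i j = if does ((p ⟨$⟩ʳ i) Fin.≟ j) then 1 else 0

sumMatrix : ∀ {m r} → (Fin r → Permutation′ m) → Matrix m
sumMatrix p i j = sum +-0-monoid (λ s → permutationMatrix (p s) i j)

Compatible : ∀ {m} → Rel (Permutation′ m) 0ℓ
Compatible p q = ∀ i → p ⟨$⟩ʳ i ≢ q ⟨$⟩ʳ i

-- The set P₂(m); two partitions are equal when their lists of parts are
-- permutations of each other.
record P₂ (m : ℕ) : Set where
  field
    parts   : List ℕ
    parts≥2 : All (2 ≤_) parts
    total   : ListAction.sum parts ≡ m

whole : ∀ {n} → 2 ≤ n → P₂ n
whole {n} 2≤n = record
  { parts = n ∷ [] ; parts≥2 = 2≤n ∷ [] ; total = +-identityʳ n }

private
  sum-replicate : ∀ d x → ListAction.sum (replicate d x) ≡ d * x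
  sum-replicate zero    x = refl
  sum-replicate (suc d) x = cong (x +_) (sum-replicate d x)

equalParts : ∀ {m n} d → 2 ≤ n → d * n ≡ m → P₂ m
equalParts {n = n} d 2≤n dn≡m = record
  { parts   = replicate d n
  ; parts≥2 = All.replicate⁺ d 2≤n
  ; total   = trans (sum-replicate d n) dn≡m
  }

-- Only meaningful for compatible p and q.
PartitionBetween : ∀ {m} → Permutation′ m → Permutation′ m → P₂ m → Set
PartitionBetween p q β =
  Σ[ L ∈ CycleList (bipartiteGraph (sumMatrix (p Vector.∷ q Vector.∷ Vector.[]))) ]
    CycleList.lengths L ↭ map (2 *_) (P₂.parts β)

-- Position u (counted from 0) of β is the partition between the
-- permutations in positions u and u + 1.
record _Represents_within_ {m r} (p : Fin r → Permutation′ m) (B : BTU m r)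
                           (β : Fin (r ∸ 1) → P₂ m) : Set where
  field
    compatible : ∀ s t → s ≢ t → Compatible (p s) (p t)
    matrix≡    : ∀ i j → BTU.matrix B i j ≡ sumMatrix p i j
    ordered    : ∀ s t → s Fin.< t → ∀ (first : Fin m) → toℕ first ≡ 0 →
                 p s ⟨$⟩ʳ first Fin.< p t ⟨$⟩ʳ first
    partitions : ∀ s t u → toℕ s ≡ toℕ u → toℕ t ≡ suc (toℕ u) →
                 PartitionBetween (p s) (p t) (β u)

Φ : ∀ {m r} → (Fin (r ∸ 1) → P₂ m) → Pred (BTU m r) 0ℓ
Φ β B = ∃[ p ] p Represents B within β

infixr 7 _∗_
_∗_ : ∀ d {n} → Permutation′ n → Permutation′ (d * n)
d ∗ q = ↔-sym (Fin.*↔× {d}) ↔-∘ ((↔-id _ ×-↔ q) ↔-∘ Fin.*↔× {d})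

A : ∀ {n} → 2 ≤ n → Permutation′ n → Pred (Permutation′ n) 0ℓ
A 2≤n p q = Compatible q p × PartitionBetween q p (whole 2≤n)

-- The set A, its elements being identified when they are equal as
-- permutations.
A-setoid : ∀ {n} → 2 ≤ n → Permutation′ n → Setoid 0ℓ 0ℓ
A-setoid {n} 2≤n p =
  On.setoid {B = Σ[ q ∈ Permutation′ n ] q ∈ A 2≤n p} (Group.setoid (Sym n)) proj₁

-- A search for an (m , r) BTU satisfying Target, in which certain
-- permutations of degree m are built from permutations of smaller
-- degrees, each sought relative to a reference permutation.
record Search (m r : ℕ) : Set₁ where
  field
    Target    : Pred (BTU m r) 0ℓ
    Step      : Set
    degree    : Step → ℕ
    degree≥2  : ∀ i → 2 ≤ degree i
    expand    : ∀ i → Permutation′ (degree i) → Permutation′ m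
    reference : ∀ i → Permutation′ (degree i)

  searchSpace : Step → Setoid 0ℓ 0ℓ
  searchSpace i = A-setoid (degree≥2 i) (reference i)

record Parameters (r m b k : ℕ) : Set where
  field
    3≤r       : 3 ≤ r
    r<m/2     : 2 * r < m
    1≤b       : 1 ≤ b
    m≡bkʳ⁻¹   : m ≡ b * k ^ (r ∸ 1)
    b-least   : ∀ b′ k′ → 1 ≤ b′ → m ≡ b′ * k′ ^ (r ∸ 1) → b ≤ b′
    composite : Composite m
    2≤k       : 2 ≤ k

  2≤bkⁱ : ∀ i → 1 ≤ i → 2 ≤ b * k ^ i
  2≤bkⁱ (suc i) _ = *-mono-≤ 1≤b (*-mono-≤ 2≤k (m^n>0 k i))
    where instance
      k≢0 : NonZero k
      k≢0 = >-nonZero (≤-trans (s≤s z≤n) 2≤k)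

  k⋯*bkⁱ≡m : ∀ i → i ≤ r ∸ 1 → k ^ (r ∸ 1 ∸ i) * (b * k ^ i) ≡ m
  k⋯*bkⁱ≡m i i≤r-1 = begin
    k ^ d * (b * k ^ i)  ≡⟨ *-comm (k ^ d) (b * k ^ i) ⟩
    b * k ^ i * k ^ d    ≡⟨ *-assoc b (k ^ i) (k ^ d) ⟩
    b * (k ^ i * k ^ d)  ≡⟨ cong (b *_) (sym (^-distribˡ-+-* k i d)) ⟩
    b * k ^ (i + d)      ≡⟨ cong (λ n → b * k ^ n) (m+[n∸m]≡n i≤r-1) ⟩
    b * k ^ (r ∸ 1)      ≡⟨ sym m≡bkʳ⁻¹ ⟩
    m                    ∎
    where
    open ≡-Reasoning
    d = r ∸ 1 ∸ i

  β : ∀ i → 1 ≤ i → i ≤ r ∸ 1 → P₂ m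
  β i 1≤i i≤r-1 = equalParts (k ^ (r ∸ 1 ∸ i)) (2≤bkⁱ i 1≤i) (k⋯*bkⁱ≡m i i≤r-1)

  search : Search m r
  search = record
    { Target    = λ B → B ∈ Φ (λ u → β (suc (toℕ u)) (s≤s z≤n) (Fin.toℕ<n u))
                      × GirthMaximum B
    ; Step      = Σ[ i ∈ ℕ ] 1 ≤ i × i ≤ r ∸ 2
    ; degree    = λ (i , _) → b * k ^ i
    ; degree≥2  = λ (i , 1≤i , _) → 2≤bkⁱ i 1≤i
    ; expand    = λ (i , _ , i≤r-2) q → subst Permutation′
        (k⋯*bkⁱ≡m i (≤-trans i≤r-2 (∸-monoʳ-≤ r (s≤s z≤n))))
        (k ^ (r ∸ 1 ∸ i) ∗ q)
      -- Rows and columns are rearranged so that the reference is the identity.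
    ; reference = λ _ → Perm.id
    }

{-# OPTIONS --safe #-}

-- Relative to the identity, q ∈ S_n has partition (n) exactly when q is an
-- n-cycle: the graph of q and the identity is 2-regular, and a path
-- column i, row i, column q i, row q i, … in it follows an orbit of q.
-- An n-cycle (0 c₁ … cₙ₋₁) is determined by the arrangement j ↦ c_j of the
-- n - 1 nonzero points, which is an arbitrary element of S_{n-1}.  Every
-- nontrivial element may serve as a generator of the Cayley graph.

module Submission where

open import Defs
open import Algebra.Bundles using (Group)
open import Data.Fin.Base as Fin
  using (Fin; zero; suc; toℕ; fromℕ; fromℕ<; inject₁; join; punchOut)
open import Data.Fin.Induction using (<-weakInduction)
open import Data.Fin.Permutation as Perm
  using (Permutation′; _⟨$⟩ʳ_; _⟨$⟩ˡ_; _∘ₚ_; flip; permutation; lift₀; remove;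
         inverseˡ; inverseʳ; lift₀-remove)
import Data.Fin.Properties as Fin
open import Data.Fin.Relation.Unary.Top using (view; ‵fromℕ; ‵inject₁)
open import Data.List.Base using (List; []; _∷_; foldr)
open import Data.List.Membership.Propositional.Properties using (∈-map⁻)
open import Data.List.Relation.Binary.Permutation.Propositional using (↭-reflexive; ↭-sym)
open import Data.List.Relation.Binary.Permutation.Propositional.Properties using (∈-resp-↭)
open import Data.List.Relation.Unary.All using (All; []; _∷_)
open import Data.List.Relation.Unary.AllPairs using ([]; _∷_)
open import Data.List.Relation.Unary.Any using (here)
open import Data.Nat.Base
  using (ℕ; zero; suc; _≤_; _<_; _∸_; _+_; _*_; _^_; z≤n; s≤s; s≤s⁻¹)
open import Data.Nat.Properties
  using (≤-trans; ≤-reflexive; ≤-antisym; <⇒≱; ≮⇒≥; <⇒≤; _<?_; <-cmp; *-comm; +-identityʳ;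
         m∸n+n≡m; m∸n≤m; m<n⇒0<n∸m; *-monoˡ-≤; *-cancelʳ-<)
open import Data.Product.Base using (Σ-syntax; ∃-syntax; _×_; _,_; proj₁; proj₂)
open import Data.Sum.Base as Sum using (_⊎_; inj₁; inj₂)
open import Data.Sum.Properties using (inj₁-injective; inj₂-injective)
import Data.Vec.Functional as Vector
open import Function.Base using (id; _∘_)
open import Function.Bundles using (Bijection; Injection; mk⇔)
open import Function.Construct.Symmetry using (↔-sym)
open import Function.Definitions using (Injective)
open import Function.Properties.Inverse using (↔⇒↣)
open import Level using (Level; 0ℓ; _⊔_) renaming (suc to lsuc)
open import Relation.Binary.Bundles using (Setoid)
open import Relation.Binary.Definitions using (tri<; tri≈; tri>)
open import Relation.Binary.PropositionalEquality
  using (_≡_; _≢_; refl; sym; trans; cong; subst; module ≡-Reasoning)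
open import Relation.Nullary.Decidable using (yes; no)
open import Relation.Nullary.Negation using (¬_; contradiction)
open import Relation.Unary using (Pred; _∈_)

private
  variable
    a ℓ e p : Level
    m n N : ℕ

-- Injections between finite sets

-- If `y` were missed, punching it out of the codomain would leave an injection into a set with
-- fewer than `m` elements.
injective⇒surjective : {f : Fin m → Fin n} → n ≤ m → Injective _≡_ _≡_ f →
                       ∀ y → ∃[ x ] f x ≡ y
injective⇒surjective {n = suc n} {f = f} n<m inj y with Fin.any? (λ x → f x Fin.≟ y)
... | yes hit = hit
... | no miss = contradiction (Fin.injective⇒≤ f′-injective) (<⇒≱ n<m)
  where
  y≢f : ∀ x → y ≢ f x
  y≢f x y≡fx = miss (x , sym y≡fx)
  f′-injective : Injective _≡_ _≡_ (λ x → punchOut (y≢f x))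
  f′-injective {x} {x′} eq = inj (Fin.punchOut-injective (y≢f x) (y≢f x′) eq)

fromInjective : (f : Fin n → Fin n) → Injective _≡_ _≡_ f → Permutation′ n
fromInjective f inj =
  permutation f (proj₁ ∘ surj) (proj₂ ∘ surj) (λ x → inj (proj₂ (surj (f x))))
  where surj = injective⇒surjective (≤-reflexive refl) inj

⟨$⟩ʳ-injective : (π : Permutation′ n) → Injective _≡_ _≡_ (π ⟨$⟩ʳ_)
⟨$⟩ʳ-injective π eq = trans (sym (inverseˡ π)) (trans (cong (π ⟨$⟩ˡ_) eq) (inverseˡ π))

-- Cyclic positions and cycles in a graph

-- Has the shape of `Traverses`, but on positions instead of vertices.
CyclicSuccessor : Fin (suc n) → Fin (suc n) → Set
CyclicSuccessor {n} h k = (∃[ j ] inject₁ j ≡ h × suc j ≡ k) ⊎ (fromℕ n ≡ h × zero ≡ k)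

successor : (j : Fin (suc n)) → ∃[ k ] CyclicSuccessor j k
successor j with view j
... | ‵fromℕ     = zero , inj₂ (refl , refl)
... | ‵inject₁ i = suc i , inj₁ (i , refl , refl)

predecessor : (j : Fin (suc n)) → ∃[ h ] CyclicSuccessor h j
predecessor {n} zero = fromℕ n , inj₂ (refl , refl)
predecessor (suc i)  = inject₁ i , inj₁ (i , refl , refl)

-- There are at least three positions, so the two neighbours of a position are distinct.
successor-asym : 2 ≤ n → {h j : Fin (suc n)} →
                 CyclicSuccessor h j → ¬ CyclicSuccessor j h
successor-asym _ (inj₁ (i , refl , refl)) (inj₁ (i′ , eq , eq′)) =
  m≢2+m _ (trans (sym (Fin.toℕ-inject₁ i))
    (trans (cong toℕ (sym eq′)) (cong suc (trans (sym (Fin.toℕ-inject₁ i′)) (cong toℕ eq)))))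
  where
  m≢2+m : ∀ m → m ≢ 2 + m
  m≢2+m (suc m) eq = m≢2+m m (cong (_∸ 1) eq)
successor-asym (s≤s (s≤s _)) (inj₁ (zero , refl , refl)) (inj₂ (() , _))
successor-asym (s≤s (s≤s _)) (inj₁ (suc i , refl , refl)) (inj₂ (_ , ()))
successor-asym (s≤s (s≤s _)) (inj₂ (refl , refl)) (inj₁ (zero , _ , ()))
successor-asym (s≤s (s≤s _)) (inj₂ (refl , refl)) (inj₁ (suc _ , () , _))
successor-asym (s≤s (s≤s _)) (inj₂ (refl , refl)) (inj₂ (() , _))

module _ (G : Graph a ℓ e) (C : Cycle G) where
  open Graph G
  private module V = Setoid Vertices
  open Cycle C

  traverses⇒adj : ∀ {x y} → Traverses x y → Adj x y
  traverses⇒adj (inj₁ (j , x≈ , y≈)) =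
    proj₁ adj-resp y≈ (proj₂ adj-resp x≈ (step j))
  traverses⇒adj (inj₂ (x≈ , y≈)) =
    proj₁ adj-resp y≈ (proj₂ adj-resp x≈ close)

  edge⇒adj : ∀ {x y} → Edge x y → Adj x y
  edge⇒adj (inj₁ t) = traverses⇒adj t
  edge⇒adj (inj₂ t) = adj-sym (traverses⇒adj t)

  -- The property travels back along the steps to position zero and from there forward to every
  -- position.
  cycle⊆adjClosed : {P : Pred Vertex p} → (∀ {x y} → Adj x y → P x → P y) →
                    ∀ i → P (at i) → ∀ j → P (at j)
  cycle⊆adjClosed {P = P} closed i Pi =
    <-weakInduction (P ∘ at) (back i Pi) (λ j → closed (step j))
    where
    back : ∀ i → P (at i) → P (at zero)
    back = <-weakInduction (λ i → P (at i) → P (at zero)) id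
      (λ j ih → ih ∘ closed (adj-sym (step j)))

  successor⇒traverses : ∀ {h k} → CyclicSuccessor h k → Traverses (at h) (at k)
  successor⇒traverses (inj₁ (j , refl , refl)) = inj₁ (j , V.refl , V.refl)
  successor⇒traverses (inj₂ (refl , refl))     = inj₂ (V.refl , V.refl)

-- Cycles in connected graphs of degree at most two

-- A degree bound without counting: two distinct neighbours exhaust all neighbours.
AtMostTwoNeighbours : Graph a ℓ e → Set (a ⊔ ℓ ⊔ e)
AtMostTwoNeighbours G =
  ∀ {x y z w} → Adj x y → Adj x z → ¬ y ≈ z → Adj x w → w ≈ y ⊎ w ≈ z
  where open Graph G

-- Connectedness as an induction principle, which avoids explicit paths.
Connected : Graph a ℓ e → Set (a ⊔ lsuc ℓ ⊔ e)
Connected {ℓ = ℓ} G =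
  (P : Pred Vertex ℓ) → (∀ {x y} → Adj x y → P x → P y) → ∀ {x} → P x → ∀ y → P y
  where open Graph G

-- All neighbours of a vertex of the cycle are its two neighbours along the
-- cycle, so by connectedness no vertex or edge is missed.
module _ (G : Graph a ℓ e) (two : AtMostTwoNeighbours G) (conn : Connected G)
         (C : Cycle G) where
  open Graph G
  private module V = Setoid Vertices
  open Cycle C

  private
    traverses-resp : ∀ {x x′ y y′} → x ≈ x′ → y ≈ y′ → Traverses x y → Traverses x′ y′
    traverses-resp p q (inj₁ (j , u , v)) = inj₁ (j , V.trans u p , V.trans v q)
    traverses-resp p q (inj₂ (u , v))     = inj₂ (V.trans u p , V.trans v q)

    adjacent : ∀ {j x y} → at j ≈ x → Adj x y → Edge x y × (∃[ k ] at k ≈ y)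
    adjacent {j} {x} {y} j≈x x~y
      with h , hj ← predecessor j | k , jk ← successor j
      with two (adj-sym (traverses⇒adj G C (successor⇒traverses G C hj)))
               (traverses⇒adj G C (successor⇒traverses G C jk))
               (λ h≈k → successor-asym (s≤s⁻¹ long) hj
                  (subst (CyclicSuccessor j) (sym (injective h≈k)) jk))
               (proj₂ adj-resp (V.sym j≈x) x~y)
    ... | inj₁ y≈h =
      inj₂ (traverses-resp (V.sym y≈h) j≈x (successor⇒traverses G C hj)) , h , V.sym y≈h
    ... | inj₂ y≈k =
      inj₁ (traverses-resp j≈x (V.sym y≈k) (successor⇒traverses G C jk)) , k , V.sym y≈k

    visits : ∀ x → ∃[ j ] at j ≈ x
    visits = conn (λ x → ∃[ j ] at j ≈ x) (λ x~y (_ , j≈x) → proj₂ (adjacent j≈x x~y))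
                  (zero , V.refl)

  adj⇒edge : ∀ {x y} → Adj x y → Edge x y
  adj⇒edge {x} x~y = proj₁ (adjacent (proj₂ (visits x)) x~y)

-- The edges of either cycle are exactly the adjacent pairs. Hence a list with a single cycle is
-- already complete.
sameCycle : (G : Graph a ℓ e) → AtMostTwoNeighbours G → Connected G →
            ∀ C D → SameCycle G C D
sameCycle G two conn C D x y = mk⇔
  (adj⇒edge G two conn D ∘ edge⇒adj G C) (adj⇒edge G two conn C ∘ edge⇒adj G D)

-- The bipartite graph of a permutation and the identity

identityMatrix : Permutation′ n → Matrix n
identityMatrix q = sumMatrix (q Vector.∷ Perm.id Vector.∷ Vector.[])

identityGraph : Permutation′ n → Graph 0ℓ 0ℓ 0ℓ
identityGraph q = bipartiteGraph (identityMatrix q)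

module _ (q : Permutation′ n) where
  open Graph (identityGraph q)

  -- Adjacency in a form that can be matched on. The converse of `adj⇒linked` needs compatibility,
  -- because a fixed point of `q` gives the entry 2.
  data Linked : Fin n ⊎ Fin n → Fin n ⊎ Fin n → Set where
    row-col   : ∀ i → Linked (inj₁ i) (inj₂ i)
    col-row   : ∀ i → Linked (inj₂ i) (inj₁ i)
    row-image : ∀ i → Linked (inj₁ i) (inj₂ (q ⟨$⟩ʳ i))
    image-row : ∀ i → Linked (inj₂ (q ⟨$⟩ʳ i)) (inj₁ i)

  private
    entry≡1⇒ : ∀ i j → identityMatrix q i j ≡ 1 → q ⟨$⟩ʳ i ≡ j ⊎ i ≡ j
    entry≡1⇒ i j eq with (q ⟨$⟩ʳ i) Fin.≟ j | i Fin.≟ j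
    ... | yes qi≡j | _       = inj₁ qi≡j
    ... | no _     | yes i≡j = inj₂ i≡j
    entry≡1⇒ i j () | no _ | no _

  adj⇒linked : ∀ x y → Adj x y → Linked x y
  adj⇒linked (inj₁ i) (inj₂ j) eq with entry≡1⇒ i j eq
  ... | inj₁ refl = row-image i
  ... | inj₂ refl = row-col i
  adj⇒linked (inj₂ j) (inj₁ i) eq with entry≡1⇒ i j eq
  ... | inj₁ refl = image-row i
  ... | inj₂ refl = col-row i

  module _ (q#id : Compatible q Perm.id) where
    private
      diagonal : ∀ i → identityMatrix q i i ≡ 1
      diagonal i with (q ⟨$⟩ʳ i) Fin.≟ i | i Fin.≟ i
      ... | yes qi≡i | _      = contradiction qi≡i (q#id i)
      ... | no _     | yes _  = refl
      ... | no _     | no i≢i = contradiction refl i≢i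

      image : ∀ i → identityMatrix q i (q ⟨$⟩ʳ i) ≡ 1
      image i with (q ⟨$⟩ʳ i) Fin.≟ (q ⟨$⟩ʳ i) | i Fin.≟ (q ⟨$⟩ʳ i)
      ... | no qi≢qi | _        = contradiction refl qi≢qi
      ... | yes _    | yes i≡qi = contradiction (sym i≡qi) (q#id i)
      ... | yes _    | no _     = refl

    linked⇒adj : ∀ {x y} → Linked x y → Adj x y
    linked⇒adj (row-col i)   = diagonal i
    linked⇒adj (col-row i)   = diagonal i
    linked⇒adj (row-image i) = image i
    linked⇒adj (image-row i) = image i

  -- Each neighbour is `near` (same index, other side) or `far` (reached through `q` or its
  -- inverse), so two distinct neighbours are these two.
  identityGraph-twoNeighbours : AtMostTwoNeighbours (identityGraph q)
  identityGraph-twoNeighbours {x} {y} {z} {w} x~y x~z y≢z x~w =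
    pigeonhole (near-or-far (adj⇒linked x y x~y)) (near-or-far (adj⇒linked x z x~z))
               (near-or-far (adj⇒linked x w x~w))
    where
    near far : Fin n ⊎ Fin n → Fin n ⊎ Fin n
    near = Sum.swap
    far (inj₁ i) = inj₂ (q ⟨$⟩ʳ i)
    far (inj₂ j) = inj₁ (q ⟨$⟩ˡ j)

    near-or-far : ∀ {x y} → Linked x y → y ≡ near x ⊎ y ≡ far x
    near-or-far (row-col i)   = inj₁ refl
    near-or-far (col-row i)   = inj₁ refl
    near-or-far (row-image i) = inj₂ refl
    near-or-far (image-row i) = inj₂ (cong inj₁ (sym (inverseˡ q)))

    pigeonhole : ∀ {u v} → y ≡ u ⊎ y ≡ v → z ≡ u ⊎ z ≡ v → w ≡ u ⊎ w ≡ v → w ≡ y ⊎ w ≡ z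
    pigeonhole (inj₁ refl) (inj₁ refl) _          = contradiction refl y≢z
    pigeonhole (inj₂ refl) (inj₂ refl) _          = contradiction refl y≢z
    pigeonhole (inj₁ refl) (inj₂ refl) w≡         = w≡
    pigeonhole (inj₂ refl) (inj₁ refl) w≡         = Sum.swap w≡

-- Permutations with a full orbit of zero

orbit : Permutation′ (suc N) → ℕ → Fin (suc N)
orbit q zero    = zero
orbit q (suc t) = q ⟨$⟩ʳ orbit q t

-- Expresses that `q` is a single cycle on all points: zero does not return to itself too early.
FullOrbit : Pred (Permutation′ (suc N)) 0ℓ
FullOrbit {N} q = ∀ d → 1 ≤ d → orbit q d ≡ zero → suc N ≤ d

orbit-cancel : (q : Permutation′ (suc N)) → ∀ i {j} → i ≤ j → orbit q i ≡ orbit q j →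
               orbit q (j ∸ i) ≡ zero
orbit-cancel q zero    _         eq = sym eq
orbit-cancel q (suc i) (s≤s i≤j) eq = orbit-cancel q i i≤j (⟨$⟩ʳ-injective q eq)

module _ (q : Permutation′ (suc N)) (full : FullOrbit q) where

  private
    separated : ∀ {i j} → i < j → j < suc N → orbit q i ≢ orbit q j
    separated {i} {j} i<j j<n eq =
      <⇒≱ j<n (≤-trans (full (j ∸ i) (m<n⇒0<n∸m i<j) (orbit-cancel q i (<⇒≤ i<j) eq))
                       (m∸n≤m j i))

  orbit-injective : ∀ {i j} → i < suc N → j < suc N → orbit q i ≡ orbit q j → i ≡ j
  orbit-injective {i} {j} i<n j<n eq with <-cmp i j
  ... | tri< i<j _ _ = contradiction eq (separated i<j j<n)
  ... | tri≈ _ i≡j _ = i≡j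
  ... | tri> _ _ j<i = contradiction (sym eq) (separated j<i i<n)

  orbit∘toℕ-injective : Injective _≡_ _≡_ (orbit q ∘ toℕ)
  orbit∘toℕ-injective {i} {j} eq =
    Fin.toℕ-injective (orbit-injective (Fin.toℕ<n i) (Fin.toℕ<n j) eq)

  orbit-surjective : ∀ x → ∃[ t ] t < suc N × orbit q t ≡ x
  orbit-surjective x
    with i , eq ← injective⇒surjective (≤-reflexive refl) orbit∘toℕ-injective x =
    toℕ i , Fin.toℕ<n i , eq

  -- The value at time `suc N` already occurs at an earlier time. If that time were positive,
  -- cancelling it would give too early a return to zero.
  orbit-period : orbit q (suc N) ≡ zero
  orbit-period with orbit-surjective (orbit q (suc N))
  ... | zero  , _       , eq = sym eq
  ... | suc t , s≤s t<N , eq = contradiction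
    (full (N ∸ t) (m<n⇒0<n∸m t<N) (orbit-cancel q t (<⇒≤ t<N) (⟨$⟩ʳ-injective q eq)))
    (<⇒≱ (s≤s (m∸n≤m N t)))

  -- Forward closure is enough: go on from `i` around the cycle to zero, then from zero to `j`.
  transitive : (P : Pred (Fin (suc N)) p) → (∀ {i} → P i → P (q ⟨$⟩ʳ i)) →
               ∀ {i} → P i → ∀ j → P j
  transitive P closed {i} Pi j
    with s , s<n , refl ← orbit-surjective i | t , _ , refl ← orbit-surjective j =
    subst (P ∘ orbit q) (+-identityʳ t) (advance t 0 (subst P orbit-period
      (subst (P ∘ orbit q) (m∸n+n≡m (<⇒≤ s<n)) (advance (suc N ∸ s) s Pi))))
    where
    advance : ∀ k s → P (orbit q s) → P (orbit q (k + s))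
    advance zero    s Ps = Ps
    advance (suc k) s Ps = closed (advance k s Ps)

  -- From row `i` through column `q i` to row `q i`, the graph follows `q` on rows; each column is
  -- adjacent to the row of its index.
  identityGraph-connected : Compatible q Perm.id → Connected (identityGraph q)
  identityGraph-connected q#id P closed {x} Px = λ where
      (inj₁ i) → rows i
      (inj₂ i) → step (row-col i) (rows i)
    where
    step : ∀ {x y} → Linked q x y → P x → P y
    step l = closed (linked⇒adj q q#id l)
    start : ∀ x → P x → ∃[ i ] P (inj₁ i)
    start (inj₁ i) Pi = i , Pi
    start (inj₂ i) Pi = i , step (col-row i) Pi
    rows : ∀ i → P (inj₁ i)
    rows = transitive (P ∘ inj₁)
      (λ {i} Pi → step (col-row (q ⟨$⟩ʳ i)) (step (row-image i) Pi))
      (proj₂ (start x Px))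

-- The alternating walk through rows and columns

module _ (q : Permutation′ (suc N)) where

  private
    image² : Fin (suc N) ⊎ Fin (suc N) → Fin (suc N) ⊎ Fin (suc N)
    image² = Sum.map (q ⟨$⟩ʳ_) (q ⟨$⟩ʳ_)

    linked-image² : ∀ {x y} → Linked q x y → Linked q (image² x) (image² y)
    linked-image² (row-col i)   = row-col _
    linked-image² (col-row i)   = col-row _
    linked-image² (row-image i) = row-image _
    linked-image² (image-row i) = image-row _

  -- Column 0, row 0, column `q 0`, row `q 0`, and so on. Advancing by two applies `q` on the
  -- current side.
  walk : ℕ → Fin (suc N) ⊎ Fin (suc N)
  walk zero          = inj₂ zero
  walk (suc zero)    = inj₁ zero
  walk (suc (suc t)) = image² (walk t)

  walk-linked : ∀ t → Linked q (walk t) (walk (suc t))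
  walk-linked zero          = col-row zero
  walk-linked (suc zero)    = row-image zero
  walk-linked (suc (suc t)) = linked-image² (walk-linked t)

  walk-even : ∀ t → walk (t * 2) ≡ inj₂ (orbit q t)
  walk-even zero    = refl
  walk-even (suc t) = cong image² (walk-even t)

  walk-odd : ∀ t → walk (suc (t * 2)) ≡ inj₁ (orbit q t)
  walk-odd zero    = refl
  walk-odd (suc t) = cong image² (walk-odd t)

-- With `t * 2`, the term `suc t * 2` reduces to two successors, in step with the recursion of
-- `walk`.
data Parity : ℕ → Set where
  even : ∀ t → Parity (t * 2)
  odd  : ∀ t → Parity (suc (t * 2))

parity : ∀ t → Parity t
parity zero          = even 0
parity (suc zero)    = odd 0
parity (suc (suc t)) with parity t
... | even s = even (suc s)
... | odd s  = odd (suc s)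

module _ (q : Permutation′ (suc N)) (full : FullOrbit q) where

  -- Parity tells columns from rows, and on each side the walk is the injective orbit.
  walk-injective : ∀ {i j} → i < suc N * 2 → j < suc N * 2 → walk q i ≡ walk q j → i ≡ j
  walk-injective {i} {j} i< j< eq with parity i | parity j
  ... | even s | even t = cong (_* 2) (orbit-injective q full
        (*-cancelʳ-< 2 s (suc N) i<) (*-cancelʳ-< 2 t (suc N) j<)
        (inj₂-injective (trans (sym (walk-even q s)) (trans eq (walk-even q t)))))
  ... | odd s  | odd t  = cong (λ t → suc (t * 2)) (orbit-injective q full
        -- Here `<⇒≤` drops the extra 1 of an odd position and leaves `s * 2 < suc N * 2`.
        (*-cancelʳ-< 2 s (suc N) (<⇒≤ i<)) (*-cancelʳ-< 2 t (suc N) (<⇒≤ j<))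
        (inj₁-injective (trans (sym (walk-odd q s)) (trans eq (walk-odd q t)))))
  ... | even s | odd t  =
        contradiction (trans (sym (walk-even q s)) (trans eq (walk-odd q t))) λ ()
  ... | odd s  | even t =
        contradiction (trans (sym (walk-odd q s)) (trans eq (walk-even q t))) λ ()

-- Full orbits and membership in `A`

-- The walk closes up after `suc N * 2` steps, and every cycle of the graph is the same as this one.
fullOrbit⇒∈A : (2≤n : 2 ≤ suc N) (q : Permutation′ (suc N)) → FullOrbit q →
               q ∈ A 2≤n Perm.id
fullOrbit⇒∈A {N} 2≤n q full = q#id , record
  { cycles   = C ∷ []
  ; distinct = [] ∷ []
  ; complete = λ D → here (sameCycle (identityGraph q) (identityGraph-twoNeighbours q)
      (identityGraph-connected q full q#id) D C)
  } , ↭-reflexive (cong (_∷ []) (*-comm (suc N) 2))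
  where
  q0≢0 : q ⟨$⟩ʳ zero ≢ zero
  q0≢0 q0≡0 = <⇒≱ 2≤n (full 1 (s≤s z≤n) q0≡0)

  q#id : Compatible q Perm.id
  -- A fixed point would spread along the orbit to zero, which would then return after one step.
  q#id i qi≡i = q0≢0 (transitive q full (λ j → q ⟨$⟩ʳ j ≡ j) (cong (q ⟨$⟩ʳ_)) qi≡i zero)

  last : ℕ
  -- Chosen so that `suc last` is `suc N * 2` by computation.
  last = suc (N * 2)

  step : ∀ t → Graph.Adj (identityGraph q) (walk q t) (walk q (suc t))
  step t = linked⇒adj q q#id (walk-linked q t)

  C : Cycle (identityGraph q)
  C = record
    { last      = last
    ; at        = walk q ∘ toℕ
    ; long      = ≤-trans (s≤s (s≤s (s≤s z≤n))) (*-monoˡ-≤ 2 2≤n)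
    ; injective = λ {i} {j} eq →
        Fin.toℕ-injective (walk-injective q full (Fin.toℕ<n i) (Fin.toℕ<n j) eq)
    ; step      = λ j → subst (λ t → Graph.Adj (identityGraph q) (walk q t) (walk q (suc (toℕ j))))
        (sym (Fin.toℕ-inject₁ j)) (step (toℕ j))
    ; close     = subst (λ t → Graph.Adj (identityGraph q) (walk q t) (inj₂ zero))
        (sym (Fin.toℕ-fromℕ last))
        (subst (Graph.Adj (identityGraph q) (walk q last))
          (trans (walk-even q (suc N)) (cong inj₂ (orbit-period q full))) (step last))
    }

-- A Hamiltonian cycle meets row 0, and if q^d 0 = 0 then the rows and
-- columns 0, q 0, …, q^{d-1} 0 are closed under adjacency.
∈A⇒fullOrbit : (2≤n : 2 ≤ suc N) (q : Permutation′ (suc N)) → q ∈ A 2≤n Perm.id →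
               FullOrbit q
∈A⇒fullOrbit {N} 2≤n q (_ , L , lengths↭) (suc d) _ qᵈ0≡0
  with C , _ , 2n≡length ← ∈-map⁻ Cycle.length (∈-resp-↭ (↭-sym lengths↭) (here refl)) =
  -- Each point is assigned an exponent below `suc d`, and the exponent determines the point.
  Fin.injective⇒≤ {f = proj₁ ∘ inOrbit}
    (λ {i} {j} eq → trans (sym (proj₂ (inOrbit i)))
      (trans (cong (orbit q ∘ toℕ) eq) (proj₂ (inOrbit j))))
  where
  open Cycle C
  InOrbit : Pred (Fin (suc N)) 0ℓ
  InOrbit i = ∃[ k ] orbit q (toℕ {suc d} k) ≡ i

  forward : ∀ i → InOrbit i → InOrbit (q ⟨$⟩ʳ i)
  forward _ (k , refl) with view k
  -- After the last exponent `d` the orbit is back at zero.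
  ... | ‵fromℕ     = zero , sym (trans (cong (orbit q ∘ suc) (Fin.toℕ-fromℕ d)) qᵈ0≡0)
  ... | ‵inject₁ j = suc j , cong (orbit q ∘ suc) (sym (Fin.toℕ-inject₁ j))

  backward : ∀ i → InOrbit (q ⟨$⟩ʳ i) → InOrbit i
  backward i (zero , eq)  = fromℕ d ,
    ⟨$⟩ʳ-injective q (trans (cong (orbit q ∘ suc) (Fin.toℕ-fromℕ d)) (trans qᵈ0≡0 eq))
  backward i (suc j , eq) = inject₁ j ,
    ⟨$⟩ʳ-injective q (trans (cong (orbit q ∘ suc) (Fin.toℕ-inject₁ j)) eq)

  -- `Sum.reduce` forgets the side, so a row and the column of the same index are treated alike.
  closed : ∀ {x y} → Linked q x y → InOrbit (Sum.reduce x) → InOrbit (Sum.reduce y)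
  closed (row-col i)   = id
  closed (col-row i)   = id
  closed (row-image i) = forward i
  closed (image-row i) = backward i

  visits : ∀ x → ∃[ j ] at j ≡ x
  visits x
    -- The cycle has as many positions as there are rows and columns together, so injectivity of
    -- `at` makes it surjective.
    with j , eq ← injective⇒surjective {f = join (suc N) (suc N) ∘ at}
      (≤-reflexive (trans (cong (suc N +_) (sym (+-identityʳ (suc N)))) 2n≡length))
      (injective ∘ Injection.injective (↔⇒↣ (↔-sym Fin.+↔⊎))) (join (suc N) (suc N) x) =
    j , Injection.injective (↔⇒↣ (↔-sym Fin.+↔⊎)) eq

  inOrbit : ∀ i → InOrbit i
  inOrbit i
    with h , h≡ ← visits (inj₁ zero) | j , j≡ ← visits (inj₁ i) =
    subst (InOrbit ∘ Sum.reduce) j≡ (cycle⊆adjClosed (identityGraph q) C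
      {P = InOrbit ∘ Sum.reduce} (λ {x} {y} → closed ∘ adj⇒linked q x y) h
      (subst (InOrbit ∘ Sum.reduce) (sym h≡) (zero , refl)) j)

-- Full cycles as arrangements of the nonzero points

-- Taken as the inverse of the predecessor map, whose injectivity follows by matching on `zero` and
-- `suc`.
rotation : Permutation′ (suc N)
rotation {N} = flip (fromInjective pred λ {i} {j} → pred-injective i j)
  where
  pred : Fin (suc N) → Fin (suc N)
  pred = proj₁ ∘ predecessor
  pred-injective : ∀ i j → pred i ≡ pred j → i ≡ j
  pred-injective zero    zero    _  = refl
  pred-injective zero    (suc j) eq = contradiction eq Fin.fromℕ≢inject₁
  pred-injective (suc i) zero    eq = contradiction (sym eq) Fin.fromℕ≢inject₁
  pred-injective (suc i) (suc j) eq = cong suc (Fin.inject₁-injective eq)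

rotation-inject₁ : (j : Fin N) → rotation ⟨$⟩ʳ inject₁ j ≡ suc j
rotation-inject₁ j = inverseʳ rotation {suc j}

-- The cycle (0 σ̂1 σ̂2 …), where σ̂ = lift₀ σ.
cycleThrough : Permutation′ N → Permutation′ (suc N)
cycleThrough σ = flip (lift₀ σ) ∘ₚ rotation ∘ₚ lift₀ σ

-- Conjugation by `lift₀ σ`, which fixes zero, carries the orbit 0, 1, 2, ... of `rotation` to its
-- image under `lift₀ σ`.
orbit-cycleThrough : (σ : Permutation′ N) (j : Fin (suc N)) →
                     orbit (cycleThrough σ) (toℕ j) ≡ lift₀ σ ⟨$⟩ʳ j
orbit-cycleThrough σ = <-weakInduction _ refl λ j ih → begin
  q ⟨$⟩ʳ orbit q (toℕ j)            ≡⟨ cong (λ t → q ⟨$⟩ʳ orbit q t) (Fin.toℕ-inject₁ j) ⟨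
  q ⟨$⟩ʳ orbit q (toℕ (inject₁ j))  ≡⟨ cong (q ⟨$⟩ʳ_) ih ⟩
  q ⟨$⟩ʳ (σ̂ ⟨$⟩ʳ inject₁ j)         ≡⟨ cong (λ x → σ̂ ⟨$⟩ʳ (rotation ⟨$⟩ʳ x)) (inverseˡ σ̂) ⟩
  σ̂ ⟨$⟩ʳ (rotation ⟨$⟩ʳ inject₁ j)  ≡⟨ cong (σ̂ ⟨$⟩ʳ_) (rotation-inject₁ j) ⟩
  σ̂ ⟨$⟩ʳ suc j                      ∎
  where
  open ≡-Reasoning
  σ̂ = lift₀ σ
  q = cycleThrough σ

cycleThrough-fullOrbit : (σ : Permutation′ N) → FullOrbit (cycleThrough σ)
-- An early return would make `lift₀ σ` send a nonzero position to zero.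
cycleThrough-fullOrbit {N} σ (suc d) _ eq = ≮⇒≥ λ d<n → contradiction
  (trans (sym (orbit-cycleThrough σ (fromℕ< d<n)))
    (trans (cong (orbit (cycleThrough σ)) (Fin.toℕ-fromℕ< d<n)) eq)) λ ()

-- The map from `t` to the orbit point at time `t` fixes zero, so removing zero restricts it to the
-- nonzero points.
arrangement : (q : Permutation′ (suc N)) → FullOrbit q → Permutation′ N
arrangement q full = remove zero (fromInjective (orbit q ∘ toℕ) (orbit∘toℕ-injective q full))

suc-arrangement : (q : Permutation′ (suc N)) (full : FullOrbit q) (j : Fin N) →
                  suc (arrangement q full ⟨$⟩ʳ j) ≡ orbit q (suc (toℕ j))
suc-arrangement q full j =
  lift₀-remove (fromInjective (orbit q ∘ toℕ) (orbit∘toℕ-injective q full)) refl (suc j)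

orbit-cong : {q q′ : Permutation′ (suc N)} → q Perm.≈ q′ → ∀ t → orbit q t ≡ orbit q′ t
orbit-cong q≈q′ zero    = refl
orbit-cong {q = q} q≈q′ (suc t) = trans (cong (q ⟨$⟩ʳ_) (orbit-cong q≈q′ t)) (q≈q′ _)

arrangement-cong : {q q′ : Permutation′ (suc N)} (full : FullOrbit q) (full′ : FullOrbit q′) →
                   q Perm.≈ q′ → arrangement q full Perm.≈ arrangement q′ full′
arrangement-cong {q = q} {q′} full full′ q≈q′ j = Fin.suc-injective
  (trans (suc-arrangement q full j)
    (trans (orbit-cong q≈q′ (suc (toℕ j))) (sym (suc-arrangement q′ full′ j))))

-- Equal arrangements give equal orbits, and a permutation with a full orbit is determined by how it
-- advances along it.
arrangement-injective :
  {q q′ : Permutation′ (suc N)} (full : FullOrbit q) (full′ : FullOrbit q′) →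
  arrangement q full Perm.≈ arrangement q′ full′ → q Perm.≈ q′
arrangement-injective {N} {q} {q′} full full′ eq x
  with t , t<n , refl ← orbit-surjective q full x =
  trans (agree t<n) (cong (q′ ⟨$⟩ʳ_) (sym (agree-below t<n)))
  where
  agreeF : ∀ j → orbit q (toℕ j) ≡ orbit q′ (toℕ j)
  agreeF zero    = refl
  agreeF (suc j) = trans (sym (suc-arrangement q full j))
    (trans (cong suc (eq j)) (suc-arrangement q′ full′ j))

  agree-below : ∀ {t} → t < suc N → orbit q t ≡ orbit q′ t
  agree-below t<n = subst (λ t → orbit q t ≡ orbit q′ t) (Fin.toℕ-fromℕ< t<n)
    (agreeF (fromℕ< t<n))

  agree : ∀ {t} → t < suc N → orbit q (suc t) ≡ orbit q′ (suc t)
  agree {t} t<n with suc t <? suc N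
  ... | yes 1+t<n = agree-below 1+t<n
  -- At the last orbit point both permutations go back to zero.
  ... | no 1+t≮n with refl ← ≤-antisym t<n (≮⇒≥ 1+t≮n) =
    trans (orbit-period q full) (sym (orbit-period q′ full′))

arrangement-cycleThrough : (σ : Permutation′ N) (full : FullOrbit (cycleThrough σ)) →
                           arrangement (cycleThrough σ) full Perm.≈ σ
arrangement-cycleThrough σ full j = Fin.suc-injective
  (trans (suc-arrangement (cycleThrough σ) full j) (orbit-cycleThrough σ (suc j)))

A⤖Sym : (2≤n : 2 ≤ n) → Bijection (A-setoid 2≤n Perm.id) (Group.setoid (Sym (n ∸ 1)))
A⤖Sym {suc N} 2≤n = record
  { to        = λ (q , q∈A) → arrangement q (∈A⇒fullOrbit 2≤n q q∈A)
  ; cong      = λ {(q , q∈A)} {(q′ , q′∈A)} →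
      arrangement-cong (∈A⇒fullOrbit 2≤n q q∈A) (∈A⇒fullOrbit 2≤n q′ q′∈A)
  ; bijective =
      (λ {(q , q∈A)} {(q′ , q′∈A)} →
        arrangement-injective (∈A⇒fullOrbit 2≤n q q∈A) (∈A⇒fullOrbit 2≤n q′ q′∈A))
    , λ σ → (cycleThrough σ , fullOrbit⇒∈A 2≤n (cycleThrough σ) (cycleThrough-fullOrbit σ))
          -- The membership proof of `q` is arbitrary, so the two orbit proofs may differ;
          -- `arrangement-cong` allows for that.
          , λ {(q , q∈A)} q≈ j → trans
              (arrangement-cong (∈A⇒fullOrbit 2≤n q q∈A) (cycleThrough-fullOrbit σ) q≈ j)
              (arrangement-cycleThrough σ (cycleThrough-fullOrbit σ) j)
  }

-- The Cayley graph

nonidentity : (n : ℕ) → ConnectionSet (Sym n)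
nonidentity n = record
  { S          = λ π → ¬ π Perm.≈ Perm.id
  ; respects   = λ π≈ρ π≉1 ρ≈1 → π≉1 λ i → trans (π≈ρ i) (ρ≈1 i)
  ; identity-∉ = λ 1≉1 → 1≉1 λ _ → refl
  ; inverse-∈  = λ {π} π≉1 π⁻¹≈1 → π≉1 λ i →
      trans (cong (π ⟨$⟩ʳ_) (sym (π⁻¹≈1 i))) (inverseʳ π)
  ; generates  = generates
  }
  where
  generates : ∀ π → Σ[ w ∈ List (Permutation′ n) ]
    All (λ π → ¬ π Perm.≈ Perm.id) w × Group._≈_ (Sym n) (foldr (Group._∙_ (Sym n)) Perm.id w) π
  -- Being the identity is decidable, so the empty word or a one-letter word suffices.
  generates π with Fin.all? (λ i → (π ⟨$⟩ʳ i) Fin.≟ i)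
  ... | yes π≈1 = [] , [] , λ i → sym (π≈1 i)
  ... | no π≉1  = π ∷ [] , π≉1 ∷ [] , λ _ → refl

theorem9 : ∀ (r m b k : ℕ) (P : Parameters r m b k) →
    ∀ (i : ℕ) (1≤i : 1 ≤ i) (i≤r-2 : i ≤ r ∸ 2) →
    Σ[ S ∈ ConnectionSet (Sym (b * k ^ i ∸ 1)) ]
      Bijection (Search.searchSpace (Parameters.search P) (i , 1≤i , i≤r-2))
                (Graph.Vertices (cayleyGraph (Sym (b * k ^ i ∸ 1)) S))
-- The vertices of the Cayley graph are the group elements with the same equality, so the bijection
-- onto the group is the one required.
theorem9 r m b k P i 1≤i i≤r-2 =
  nonidentity (b * k ^ i ∸ 1) , A⤖Sym (Parameters.2≤bkⁱ P i 1≤i)
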